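{- Let $n \ge 1$ be an integer, let $j = 4$ with $j \le 2n$, and let $N = n^2 + j = n^2+4$. If $n$ is even, then the length of the period of the continued fraction of $\sqrt{N}$ is $2$ and $\sqrt{N} = [n, \overline{\tfrac{2n}{j}, 2n}]$. If $n$ is odd, then the length of the period is $5$ and $\sqrt{N} = [n, \overline{\tfrac{n-1}{2}, 1, 1, \tfrac{n-1}{2}, 2n}]$.
   Context: The (simple) continued fraction expansion of an irrational real number $x$ is the unique infinite sequence $[a_0,a_1,a_2,\dots]$ with $a_0\in\mathbb Z$ and $a_i$ a positive integer for $i\ge 1$, such that the convergents $a_0+\cfrac{1}{a_1+\cfrac{1}{\ddots+\cfrac{1}{a_m}}}$ converge to $x$ as $m\to\infty$. The notation $[a_0,\dots,a_k,\overline{a_{k+1},\dots,a_\ell}]$ means that the block $a_{k+1},\dots,a_\ell$ is repeated infinitely many times after the preperiod $a_0,\dots,a_k$. The length of the period is the number of entries in the shortest repeating block. -}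

module Defs where

open import Data.Integer as ℤ using (ℤ; +_)
open import Data.List using (List; []; _∷_; lookup)
open import Data.List.NonEmpty as List⁺ using (List⁺; toList)
open import Data.Nat as ℕ using (ℕ; zero; suc)
open import Data.Nat.DivMod using (_mod_)
open import Data.Product using (∃; ∃-syntax; _×_; _,_)
open import Data.Rational
open import Data.Rational.Properties
open import Data.Rational.Solver using (module +-*-Solver)
open import Data.Sum using (_⊎_; inj₁; inj₂)
open import Function using (_∘_)
open import Relation.Binary.PropositionalEquality
open import Relation.Nullary using (¬_; yes; no; contradiction)

------------------------------------------------------------------------
-- Real numbers

-- Two-sided Dedekind cuts: Lower q means q < x and Upper q means x < q.
record ℝ : Set₁ where
  field
    Lower Upper : ℚ → Set
    lower-inhabited : ∃ Lower
    upper-inhabited : ∃ Upper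
    lower-closed    : ∀ {p q} → p < q → Lower q → Lower p
    upper-closed    : ∀ {p q} → p < q → Upper p → Upper q
    lower-open      : ∀ {q} → Lower q → ∃[ r ] q < r × Lower r
    upper-open      : ∀ {q} → Upper q → ∃[ r ] r < q × Upper r
    disjoint        : ∀ {q} → ¬ (Lower q × Upper q)
    located         : ∀ {p q} → p < q → Lower p ⊎ Upper q

-- ∣ u m - x ∣ < ε is written as u m - ε < x < u m + ε.
_⟶_ : (ℕ → ℚ) → ℝ → Set
u ⟶ x = ∀ ε → 0ℚ < ε → ∃[ M ] ∀ m → M ℕ.≤ m →
          ℝ.Lower x (u m - ε) × ℝ.Upper x (u m + ε)

------------------------------------------------------------------------
-- The square root of a natural number

fromℕ : ℕ → ℚ
fromℕ n = + n / 1

private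
  square-mono-< : ∀ {p q} → 0ℚ ≤ p → p < q → p * p < q * q
  square-mono-< {p} {q} 0≤p p<q = ≤-<-trans
    (*-monoˡ-≤-nonNeg p {{nonNegative 0≤p}} (<⇒≤ p<q))
    (*-monoˡ-<-pos q {{positive (≤-<-trans 0≤p p<q)}} p<q)

  fromℕ-nonNeg : ∀ n → 0ℚ ≤ fromℕ n
  fromℕ-nonNeg n = nonNegative⁻¹ (fromℕ n) {{normalize-nonNeg n 1}}

  0<1 : 0ℚ < 1ℚ
  0<1 = positive⁻¹ 1ℚ

  x<x+y : ∀ x {y} → 0ℚ < y → x < x + y
  x<x+y x {y} 0<y = subst (_< x + y) (+-identityʳ x) (+-monoʳ-< x 0<y)

  x≤x+y : ∀ x {y} → 0ℚ ≤ y → x ≤ x + y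
  x≤x+y x {y} 0≤y = subst (_≤ x + y) (+-identityʳ x) (+-monoʳ-≤ x 0≤y)

  x-y<x : ∀ x {y} → 0ℚ < y → x - y < x
  x-y<x x {y} 0<y =
    subst (x - y <_) (+-identityʳ x) (+-monoʳ-< x (neg-antimono-< 0<y))

  x<y⇒0<y-x : ∀ {x y} → x < y → 0ℚ < y - x
  x<y⇒0<y-x {x} {y} x<y =
    subst (_< y - x) (+-inverseʳ x) (+-monoˡ-< (- x) x<y)

  0<xy : ∀ {x y} → 0ℚ < x → 0ℚ < y → 0ℚ < x * y
  0<xy {x} {y} 0<x 0<y =
    positive⁻¹ (x * y) {{pos*pos⇒pos x {{positive 0<x}} y {{positive 0<y}}}}

  0≤xy : ∀ {x y} → 0ℚ ≤ x → 0ℚ ≤ y → 0ℚ ≤ x * y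
  0≤xy {x} {y} 0≤x 0≤y = nonNegative⁻¹ (x * y)
    {{nonNeg*nonNeg⇒nonNeg x {{nonNegative 0≤x}} y {{nonNegative 0≤y}}}}

  divide : ∀ {e} d → 0ℚ < d → 0ℚ < e → ∃[ s ] 0ℚ < s × s * d ≡ e
  divide {e} d 0<d 0<e = e * inv , 0<xy 0<e 0<inv ,
    trans (*-assoc e inv d)
      (trans (cong (e *_) (*-inverseˡ d {{nz}})) (*-identityʳ e))
    where
    nz = pos⇒nonZero d {{positive 0<d}}
    inv = (1/ d) {{nz}}
    0<inv : 0ℚ < inv
    0<inv = positive⁻¹ inv {{1/pos⇒pos d {{positive 0<d}}}}

√Lower √Upper : ℚ → ℚ → Set
√Lower n q = q < 0ℚ ⊎ q * q < n
√Upper n q = 0ℚ < q × n < q * q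

private
  √-lower-closed : ∀ n {p q} → p < q → √Lower n q → √Lower n p
  √-lower-closed n p<q (inj₁ q<0) = inj₁ (<-trans p<q q<0)
  √-lower-closed n {p} p<q (inj₂ q²<n) with p <? 0ℚ
  ... | yes p<0 = inj₁ p<0
  ... | no  p≮0 = inj₂ (<-trans (square-mono-< (≮⇒≥ p≮0) p<q) q²<n)

  √-upper-closed : ∀ n {p q} → p < q → √Upper n p → √Upper n q
  √-upper-closed n p<q (0<p , n<p²) =
    <-trans 0<p p<q , <-trans n<p² (square-mono-< (<⇒≤ 0<p) p<q)

  -- Take r = q + s with s (1 + 2 q + e) = e and e = n - q².
  step-up : ∀ n q e s → e ≡ n - q * q → 0ℚ ≤ q → 0ℚ < e → 0ℚ < s →
            s * (1ℚ + (q + q + e)) ≡ e → (q + s) * (q + s) < n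
  step-up n q e s e≡ 0≤q 0<e 0<s sd≡e = subst₂ _<_ lhs rhs
    (+-monoʳ-< (q * q) (*-monoʳ-<-pos s {{positive 0<s}} inner))
    where
    open +-*-Solver
    0<1+2q : 0ℚ < 1ℚ + (q + q)
    0<1+2q = <-≤-trans 0<1 (x≤x+y 1ℚ (+-mono-≤ 0≤q 0≤q))
    expand : s * e + s * (1ℚ + (q + q)) ≡ s * (1ℚ + (q + q + e))
    expand = solve 4 (λ s q e o →
      s :* e :+ s :* (o :+ (q :+ q)) := s :* (o :+ (q :+ q :+ e))) refl s q e 1ℚ
    s<1 : s < 1ℚ
    s<1 = *-cancelʳ-<-nonNeg e {{nonNegative (<⇒≤ 0<e)}}
      (subst (s * e <_) (trans expand (trans sd≡e (sym (*-identityˡ e))))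
        (x<x+y (s * e) (0<xy 0<s 0<1+2q)))
    inner : q + q + s < 1ℚ + (q + q + e)
    inner = subst₂ _<_ (+-comm s (q + q)) (+-assoc 1ℚ (q + q) e)
      (<-≤-trans (+-monoˡ-< (q + q) s<1) (x≤x+y (1ℚ + (q + q)) (<⇒≤ 0<e)))
    lhs : q * q + s * (q + q + s) ≡ (q + s) * (q + s)
    lhs = solve 2 (λ q s →
      q :* q :+ s :* (q :+ q :+ s) := (q :+ s) :* (q :+ s)) refl q s
    rhs : q * q + s * (1ℚ + (q + q + e)) ≡ n
    rhs = trans (cong (λ t → q * q + t) (trans sd≡e e≡))
      (solve 2 (λ x n → x :+ (n :- x) := n) refl (q * q) n)

  √-lower-open-nonNeg : ∀ n q → 0ℚ ≤ q → q * q < n →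
                        ∃[ r ] q < r × √Lower n r
  √-lower-open-nonNeg n q 0≤q q²<n =
    let (s , 0<s , sd≡e) = divide (1ℚ + (q + q + e)) 0<d 0<e
    in q + s , x<x+y q 0<s , inj₂ (step-up n q e s refl 0≤q 0<e 0<s sd≡e)
    where
    e = n - q * q
    0<e : 0ℚ < e
    0<e = x<y⇒0<y-x q²<n
    0<d : 0ℚ < 1ℚ + (q + q + e)
    0<d = <-≤-trans 0<1
      (x≤x+y 1ℚ (+-mono-≤ (+-mono-≤ 0≤q 0≤q) (<⇒≤ 0<e)))

  √-lower-open : ∀ n {q} → √Lower n q → ∃[ r ] q < r × √Lower n r
  √-lower-open n (inj₁ q<0) =
    let (r , q<r , r<0) = <-dense q<0 in r , q<r , inj₁ r<0
  √-lower-open n {q} (inj₂ q²<n) with q <? 0ℚ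
  ... | yes q<0 = let (r , q<r , r<0) = <-dense q<0 in r , q<r , inj₁ r<0
  ... | no  q≮0 = √-lower-open-nonNeg n q (≮⇒≥ q≮0) q²<n

  -- Take r = q - s with 2 q s = q² - n, so that r² = n + s².
  step-down : ∀ n q e s → e ≡ q * q - n → s * (q + q) ≡ e →
              n + s * s ≡ (q - s) * (q - s)
  step-down n q e s e≡ sd≡e = trans
    (solve 3 (λ n x y → n :+ y := (x :- (x :- n)) :+ y) refl n (q * q) (s * s))
    (trans (cong (λ t → q * q - t + s * s) (sym (trans sd≡e e≡)))
      (solve 2 (λ q s →
        q :* q :- s :* (q :+ q) :+ s :* s := (q :- s) :* (q :- s)) refl q s))
    where open +-*-Solver

  √-upper-open : ∀ n → 0ℚ ≤ n → ∀ {q} → √Upper n q → ∃[ r ] r < q × √Upper n r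
  √-upper-open n 0≤n {q} (0<q , n<q²) =
    let (s , 0<s , sd≡e) = divide (q + q) 0<2q (x<y⇒0<y-x n<q²)
    in q - s , x-y<x q 0<s , x<y⇒0<y-x (s<q s sd≡e) ,
       subst (n <_) (step-down n q (q * q - n) s refl sd≡e)
         (x<x+y n (0<xy 0<s 0<s))
    where
    0<2q : 0ℚ < q + q
    0<2q = +-mono-< 0<q 0<q
    q²-n≤q² : q * q - n ≤ q * q
    q²-n≤q² = subst (q * q - n ≤_) (+-identityʳ (q * q))
      (+-monoʳ-≤ (q * q) (neg-antimono-≤ 0≤n))
    q²<q[q+q] : q * q < q * (q + q)
    q²<q[q+q] = subst (q * q <_) (sym (*-distribˡ-+ q q q))
      (x<x+y (q * q) (0<xy 0<q 0<q))
    s<q : ∀ s → s * (q + q) ≡ q * q - n → s < q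
    s<q s sd≡e = *-cancelʳ-<-nonNeg (q + q) {{nonNegative (<⇒≤ 0<2q)}}
      (subst (_< q * (q + q)) (sym sd≡e) (≤-<-trans q²-n≤q² q²<q[q+q]))

  √-located : ∀ n {p q} → p < q → √Lower n p ⊎ √Upper n q
  √-located n {p} p<q with p <? 0ℚ
  ... | yes p<0 = inj₁ (inj₁ p<0)
  ... | no  p≮0 with p * p <? n
  ...   | yes p²<n = inj₁ (inj₂ p²<n)
  ...   | no  p²≮n = inj₂
          ( ≤-<-trans (≮⇒≥ p≮0) p<q
          , ≤-<-trans (≮⇒≥ p²≮n) (square-mono-< (≮⇒≥ p≮0) p<q) )

  √-disjoint : ∀ n {q} → ¬ (√Lower n q × √Upper n q)
  √-disjoint n (inj₁ q<0  , 0<q , n<q²) = <-asym q<0 0<q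
  √-disjoint n (inj₂ q²<n , 0<q , n<q²) = <-asym q²<n n<q²

  √-upper-inhabited : ∀ n → 0ℚ ≤ n → √Upper n (n + 1ℚ)
  √-upper-inhabited n 0≤n =
    0<n+1 , <-≤-trans (x<x+y n 0<1) (subst (n + 1ℚ ≤_) expand
      (x≤x+y (n + 1ℚ) (0≤xy 0≤n (<⇒≤ 0<n+1))))
    where
    0<n+1 : 0ℚ < n + 1ℚ
    0<n+1 = ≤-<-trans 0≤n (x<x+y n 0<1)
    expand : (n + 1ℚ) + n * (n + 1ℚ) ≡ (n + 1ℚ) * (n + 1ℚ)
    expand = trans (+-comm (n + 1ℚ) (n * (n + 1ℚ)))
      (trans (cong (λ t → n * (n + 1ℚ) + t) (sym (*-identityˡ (n + 1ℚ))))
        (sym (*-distribʳ-+ (n + 1ℚ) n 1ℚ)))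

√ : ℕ → ℝ
√ N = record
  { Lower           = √Lower (fromℕ N)
  ; Upper           = √Upper (fromℕ N)
  ; lower-inhabited = - 1ℚ , inj₁ (negative⁻¹ (- 1ℚ))
  ; upper-inhabited = fromℕ N + 1ℚ , √-upper-inhabited (fromℕ N) (fromℕ-nonNeg N)
  ; lower-closed    = √-lower-closed (fromℕ N)
  ; upper-closed    = √-upper-closed (fromℕ N)
  ; lower-open      = √-lower-open (fromℕ N)
  ; upper-open      = √-upper-open (fromℕ N) (fromℕ-nonNeg N)
  ; disjoint        = √-disjoint (fromℕ N)
  ; located         = √-located (fromℕ N)
  }

------------------------------------------------------------------------
-- Simple continued fractions

TailPositive : (ℕ → ℤ) → Set
TailPositive a = ∀ i → + 0 ℤ.< a (suc i)

-- convergent a a⁺ m is a₀ + 1/(a₁ + 1/(⋯ + 1/a_m)).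
convergent : (a : ℕ → ℤ) → TailPositive a → ℕ → ℚ
convergent-positive : ∀ a (a⁺ : TailPositive a) → + 0 ℤ.< a 0 →
                      ∀ m → Positive (convergent a a⁺ m)

convergent a a⁺ zero    = a 0 / 1
convergent a a⁺ (suc m) = a 0 / 1 + (1/ tail) {{tail≢0}}
  where
  tail = convergent (a ∘ suc) (a⁺ ∘ suc) m
  tail≢0 = pos⇒nonZero tail
             {{convergent-positive (a ∘ suc) (a⁺ ∘ suc) (a⁺ 0) m}}

private
  /1-positive : ∀ {z} → + 0 ℤ.< z → Positive (z / 1)
  /1-positive {+ suc k} _ = normalize-pos (suc k) 1
  /1-positive {+ zero}  (ℤ.+<+ ())

convergent-positive a a⁺ 0<a₀ zero    = /1-positive 0<a₀
convergent-positive a a⁺ 0<a₀ (suc m) =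
  pos+pos⇒pos (a 0 / 1) {{/1-positive 0<a₀}} _
    {{1/pos⇒pos (convergent (a ∘ suc) (a⁺ ∘ suc) m)
       {{convergent-positive (a ∘ suc) (a⁺ ∘ suc) (a⁺ 0) m}}}}

record _HasContinuedFraction_ (x : ℝ) (a : ℕ → ℤ) : Set where
  field
    tailPositive : TailPositive a
    converges    : convergent a tailPositive ⟶ x

------------------------------------------------------------------------
-- Eventually periodic sequences

[_,overline_] : ∀ {A : Set} → List A → List⁺ A → ℕ → A
[ []     ,overline b ] i       = lookup (toList b) (i mod List⁺.length b)
[ x ∷ xs ,overline b ] zero    = x
[ x ∷ xs ,overline b ] (suc i) = [ xs ,overline b ] i

IsRepeatingBlock : (ℕ → ℤ) → List⁺ ℤ → Set
IsRepeatingBlock a b = ∃[ pre ] a ≗ [ pre ,overline b ]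

record SequencePeriodLength (a : ℕ → ℤ) (ℓ : ℕ) : Set where
  field
    attained : ∃[ b ] IsRepeatingBlock a b × List⁺.length b ≡ ℓ
    shortest : ∀ b → IsRepeatingBlock a b → ℓ ℕ.≤ List⁺.length b

-- A real number has at most one simple continued fraction expansion, so
-- the existential picks out the expansion of x.
PeriodLength : ℝ → ℕ → Set
PeriodLength x ℓ = ∃[ a ] x HasContinuedFraction a × SequencePeriodLength a ℓ

{-# OPTIONS --safe #-}

-- Write x and y for the convergents of index m and m + ℓ, where ℓ is the
-- period. Going once through the period gives y = (A x + N B) / (B x + A)
-- with A² - N B² = ±1: (A, B) = (nk + 1, k) for n = 2k, and
-- (A, B) = (n (c + 1), c) with c = 2k² + 2k + 1 for n = 2k + 1. Therefore
-- (y² - N) (B x + A)² = ±(x² - N), and since B x + A ≥ 2 the squares of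
-- the convergents tend to N. The block is shortest because its last entry
-- 2n occurs nowhere else in it.

module Submission where

open import Defs

-- Anonymous, so that the operators of ℚ do not clash with those of ℕ below.
module _ where
  open import Data.Fin as Fin using (Fin; zero; suc; toℕ)
  import Data.Fin.Properties as Fin
  open import Data.Integer as ℤ using (ℤ; +_)
  import Data.Integer.Properties as ℤ
  open import Data.List using (List; []; _∷_; length; lookup)
  open import Data.List.NonEmpty as List⁺ using (List⁺; _∷_; toList)
  open import Data.Nat as ℕ using (ℕ; zero; suc)
  open import Data.Nat.DivMod using (_mod_)
  import Data.Nat.DivMod as ℕ
  import Data.Nat.Properties as ℕ
  open import Data.Product using (∃-syntax; _×_; _,_)
  open import Data.Rational
  open import Data.Rational.Properties
  open import Data.Rational.Solver using (module +-*-Solver)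
  import Data.Rational.Unnormalised as ℚᵘ
  import Data.Rational.Unnormalised.Properties as ℚᵘ
  open import Data.Sum using (inj₁; inj₂; [_,_]′)
  open import Function using (_∘_)
  open import Relation.Binary.PropositionalEquality
  open import Relation.Nullary using (yes; no)

  -- The embedding of ℕ in ℚ, order, and the Archimedean property.

  fromℕ-+ : ∀ m n → fromℕ (m ℕ.+ n) ≡ fromℕ m + fromℕ n
  fromℕ-+ m n = toℚᵘ-injective (begin
    toℚᵘ (fromℕ (m ℕ.+ n))            ≈⟨ toℚᵘ-fromℚᵘ (ℚᵘ.mkℚᵘ (+ (m ℕ.+ n)) 0) ⟩
    ℚᵘ.mkℚᵘ (+ (m ℕ.+ n)) 0           ≈⟨ ℚᵘ.*≡* (cong (ℤ._* + 1) (sym (cong₂ ℤ._+_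
                                           (ℤ.*-identityʳ (+ m)) (ℤ.*-identityʳ (+ n))))) ⟩
    ℚᵘ.mkℚᵘ (+ m) 0 ℚᵘ.+ ℚᵘ.mkℚᵘ (+ n) 0
      ≈⟨ ℚᵘ.+-cong (toℚᵘ-fromℚᵘ (ℚᵘ.mkℚᵘ (+ m) 0)) (toℚᵘ-fromℚᵘ (ℚᵘ.mkℚᵘ (+ n) 0)) ⟨
    toℚᵘ (fromℕ m) ℚᵘ.+ toℚᵘ (fromℕ n)  ≈⟨ toℚᵘ-homo-+ (fromℕ m) (fromℕ n) ⟨
    toℚᵘ (fromℕ m + fromℕ n)          ∎)
    where open ℚᵘ.≃-Reasoning

  fromℕ-* : ∀ m n → fromℕ (m ℕ.* n) ≡ fromℕ m * fromℕ n
  fromℕ-* zero    n = sym (*-zeroˡ (fromℕ n))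
  fromℕ-* (suc m) n = begin
    fromℕ (n ℕ.+ m ℕ.* n)               ≡⟨ fromℕ-+ n (m ℕ.* n) ⟩
    fromℕ n + fromℕ (m ℕ.* n)           ≡⟨ cong₂ _+_ (sym (*-identityˡ (fromℕ n))) (fromℕ-* m n) ⟩
    1ℚ * fromℕ n + fromℕ m * fromℕ n    ≡⟨ *-distribʳ-+ (fromℕ n) 1ℚ (fromℕ m) ⟨
    (1ℚ + fromℕ m) * fromℕ n            ≡⟨ cong (_* fromℕ n) (fromℕ-+ 1 m) ⟨
    fromℕ (suc m) * fromℕ n             ∎
    where open ≡-Reasoning

  0≤fromℕ : ∀ n → 0ℚ ≤ fromℕ n
  0≤fromℕ n = nonNegative⁻¹ (fromℕ n) {{normalize-nonNeg n 1}}

  p≤p+q : ∀ p {q} → 0ℚ ≤ q → p ≤ p + q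
  p≤p+q p {q} 0≤q = subst (_≤ p + q) (+-identityʳ p) (+-monoʳ-≤ p 0≤q)

  fromℕ-mono-≤ : ∀ {m n} → m ℕ.≤ n → fromℕ m ≤ fromℕ n
  fromℕ-mono-≤ {m} {n} m≤n = subst (fromℕ m ≤_)
    (trans (sym (fromℕ-+ m (n ℕ.∸ m))) (cong fromℕ (ℕ.m+[n∸m]≡n m≤n)))
    (p≤p+q (fromℕ m) (0≤fromℕ (n ℕ.∸ m)))

  -- The denominator is at least 1, so `p` is at most the absolute value of its numerator.
  p<fromℕ[1+∣↥p∣] : ∀ p → p < fromℕ (suc ℤ.∣ ↥ p ∣)
  p<fromℕ[1+∣↥p∣] p@record{} = toℚᵘ-cancel-< (ℚᵘ.<-respʳ-≃
    (ℚᵘ.≃-sym (toℚᵘ-fromℚᵘ (ℚᵘ.mkℚᵘ (+ suc ℤ.∣ ↥ p ∣) 0))) (ℚᵘ.*<* (begin-strict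
      ↥ p ℤ.* + 1                  ≡⟨ ℤ.*-identityʳ (↥ p) ⟩
      ↥ p                          <⟨ i<1+∣i∣ (↥ p) ⟩
      + suc ℤ.∣ ↥ p ∣              ≡⟨ ℤ.*-identityʳ (+ suc ℤ.∣ ↥ p ∣) ⟨
      + suc ℤ.∣ ↥ p ∣ ℤ.* + 1      ≤⟨ ℤ.*-monoˡ-≤-nonNeg (+ suc ℤ.∣ ↥ p ∣) (ℤ.+≤+ (ℕ.s≤s ℕ.z≤n)) ⟩
      + suc ℤ.∣ ↥ p ∣ ℤ.* ↧ p      ∎)))
    where
    open ℤ.≤-Reasoning
    i<1+∣i∣ : ∀ i → i ℤ.< + suc ℤ.∣ i ∣
    i<1+∣i∣ (+ n)      = ℤ.+<+ ℕ.≤-refl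
    i<1+∣i∣ ℤ.-[1+ n ] = ℤ.-<+

  archimedean : ∀ p {q} → 0ℚ < q → ∃[ k ] p < fromℕ k * q
  archimedean p {q} 0<q = k , subst (_< fromℕ k * q) p/q*q≡p
    (*-monoˡ-<-pos q {{positive 0<q}} (p<fromℕ[1+∣↥p∣] (p * 1/q)))
    where
    instance
      q≢0 = >-nonZero 0<q
    1/q = 1/ q
    k = suc ℤ.∣ ↥ (p * 1/q) ∣
    p/q*q≡p : p * 1/q * q ≡ p
    p/q*q≡p = trans (*-assoc p 1/q q) (trans (cong (p *_) (*-inverseˡ q)) (*-identityʳ p))

  0≤p*q : ∀ {p q} → 0ℚ ≤ p → 0ℚ ≤ q → 0ℚ ≤ p * q
  0≤p*q {p} {q} 0≤p 0≤q = nonNegative⁻¹ (p * q)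
    {{nonNeg*nonNeg⇒nonNeg p {{nonNegative 0≤p}} q {{nonNegative 0≤q}}}}

  p<p+q : ∀ p {q} → 0ℚ < q → p < p + q
  p<p+q p {q} 0<q = subst (_< p + q) (+-identityʳ p) (+-monoʳ-< p 0<q)

  p≤q⇒0≤q-p : ∀ {p q} → p ≤ q → 0ℚ ≤ q - p
  p≤q⇒0≤q-p {p} {q} p≤q = subst (_≤ q - p) (+-inverseʳ p) (+-monoˡ-≤ (- p) p≤q)

  p<q⇒0<q-p : ∀ {p q} → p < q → 0ℚ < q - p
  p<q⇒0<q-p {p} {q} p<q = subst (_< q - p) (+-inverseʳ p) (+-monoˡ-< (- p) p<q)

  p≤∣p∣ : ∀ p → p ≤ ∣ p ∣
  p≤∣p∣ p with ≤-total 0ℚ p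
  ... | inj₁ 0≤p = ≤-reflexive (sym (0≤p⇒∣p∣≡p 0≤p))
  ... | inj₂ p≤0 = ≤-trans p≤0 (0≤∣p∣ p)

  -- Sequences that halve every `ℓ` steps.

  bounded-on-initial-segment : ∀ ℓ (f : ℕ → ℚ) → ∃[ C ] (∀ r → r ℕ.< ℓ → f r ≤ C)
  bounded-on-initial-segment zero    f = 0ℚ , λ _ ()
  bounded-on-initial-segment (suc ℓ) f with bounded-on-initial-segment ℓ f
  ... | C , f≤C = f ℓ ⊔ C , λ r r<1+ℓ → [ (λ r<ℓ → ≤-trans (f≤C r r<ℓ) (p≤q⊔p (f ℓ) C))
                                        , (λ { refl → p≤p⊔q (f ℓ) C })
                                        ]′ (ℕ.m<1+n⇒m<n∨m≡n r<1+ℓ)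

  module _ (ℓ : ℕ) .{{_ : ℕ.NonZero ℓ}} (f : ℕ → ℚ)
           (0≤f : ∀ m → 0ℚ ≤ f m) (halves : ∀ m → f (ℓ ℕ.+ m) + f (ℓ ℕ.+ m) ≤ f m) where

    -- Halving `k` times divides by 2^k, but the factor `k + 1` is enough for a limit, and it
    -- survives the induction because `k + 2 ≤ 2 (k + 1)`.
    halving-bound : ∀ k m → fromℕ (suc k) * f (k ℕ.* ℓ ℕ.+ m) ≤ f m
    halving-bound zero    m = ≤-reflexive (*-identityˡ (f m))
    halving-bound (suc k) m = begin
      fromℕ (2 ℕ.+ k) * f (ℓ ℕ.+ k ℕ.* ℓ ℕ.+ m)     ≡⟨ cong (λ i → fromℕ (2 ℕ.+ k) * f i) (ℕ.+-assoc ℓ (k ℕ.* ℓ) m) ⟩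
      fromℕ (2 ℕ.+ k) * x                   ≤⟨ *-monoʳ-≤-nonNeg x {{nonNegative 0≤x}} 2+k≤2[1+k] ⟩
      fromℕ (suc k ℕ.+ suc k) * x           ≡⟨ cong (_* x) (fromℕ-+ (suc k) (suc k)) ⟩
      (fromℕ (suc k) + fromℕ (suc k)) * x   ≡⟨ *-distribʳ-+ x (fromℕ (suc k)) (fromℕ (suc k)) ⟩
      fromℕ (suc k) * x + fromℕ (suc k) * x ≡⟨ *-distribˡ-+ (fromℕ (suc k)) x x ⟨
      fromℕ (suc k) * (x + x)               ≤⟨ *-monoˡ-≤-nonNeg (fromℕ (suc k)) {{normalize-nonNeg (suc k) 1}}
                                                 (halves (k ℕ.* ℓ ℕ.+ m)) ⟩
      fromℕ (suc k) * f (k ℕ.* ℓ ℕ.+ m)     ≤⟨ halving-bound k m ⟩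
      f m                                   ∎
      where
      open ≤-Reasoning
      x = f (ℓ ℕ.+ (k ℕ.* ℓ ℕ.+ m))
      0≤x = 0≤f (ℓ ℕ.+ (k ℕ.* ℓ ℕ.+ m))
      2+k≤2[1+k] : fromℕ (2 ℕ.+ k) ≤ fromℕ (suc k ℕ.+ suc k)
      2+k≤2[1+k] = fromℕ-mono-≤ (ℕ.s≤s (ℕ.m≤n+m (suc k) k))

    -- With `m = k ℓ + r` and `r < ℓ`, the value `f m` is at most `f r / (k + 1)`. The finitely many
    -- `f r` have a common bound `C`, and `C < K ε` for some `K`; beyond `K ℓ` the quotient `k` is
    -- at least `K`.
    halving⇒vanishing : ∀ ε → 0ℚ < ε → ∃[ M ] (∀ m → M ℕ.≤ m → f m < ε)
    halving⇒vanishing ε 0<ε with bounded-on-initial-segment ℓ f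
    ... | C , f≤C with archimedean C 0<ε
    ...   | K , C<Kε = K ℕ.* ℓ , λ m Kℓ≤m →
        small m (subst (ℕ._≤ m ℕ./ ℓ) (ℕ.m*n/n≡m K ℓ) (ℕ./-monoˡ-≤ ℓ Kℓ≤m))
      where
      small : ∀ m → K ℕ.≤ m ℕ./ ℓ → f m < ε
      small m K≤k = *-cancelˡ-<-nonNeg (fromℕ (suc k)) {{normalize-nonNeg (suc k) 1}} (begin-strict
        fromℕ (suc k) * f m             ≡⟨ cong (λ i → fromℕ (suc k) * f i) m≡kℓ+r ⟩
        fromℕ (suc k) * f (k ℕ.* ℓ ℕ.+ r) ≤⟨ halving-bound k r ⟩
        f r                             ≤⟨ f≤C r (ℕ.m%n<n m ℓ) ⟩
        C                               <⟨ C<Kε ⟩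
        fromℕ K * ε                     ≤⟨ *-monoʳ-≤-nonNeg ε {{nonNegative (<⇒≤ 0<ε)}}
                                             (fromℕ-mono-≤ (ℕ.m≤n⇒m≤1+n K≤k)) ⟩
        fromℕ (suc k) * ε               ∎)
        where
        open ≤-Reasoning
        k = m ℕ./ ℓ
        r = m ℕ.% ℓ
        m≡kℓ+r : m ≡ k ℕ.* ℓ ℕ.+ r
        m≡kℓ+r = trans (ℕ.m≡m%n+[m/n]*n m ℓ) (ℕ.+-comm r (k ℕ.* ℓ))

  -- From convergence of the squares to convergence to √N.

  ∣u²-N∣<ε⇒∣u-√N∣<ε : ∀ N {u ε} → 1ℚ ≤ u → 0ℚ < ε → ∣ u * u - fromℕ N ∣ < ε →
                      ℝ.Lower (√ N) (u - ε) × ℝ.Upper (√ N) (u + ε)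
  ∣u²-N∣<ε⇒∣u-√N∣<ε N {u} {ε} 1≤u 0<ε ∣d∣<ε = lower , 0<u+ε , upper
    where
    open +-*-Solver
    d = u * u - fromℕ N
    0≤ε = <⇒≤ 0<ε
    0≤u-1 = p≤q⇒0≤q-p 1≤u
    0≤u : 0ℚ ≤ u
    0≤u = ≤-trans (0≤fromℕ 1) 1≤u
    0<u+ε : 0ℚ < u + ε
    0<u+ε = +-mono-≤-< 0≤u 0<ε
    0<ε-d : 0ℚ < ε - d
    0<ε-d = p<q⇒0<q-p (≤-<-trans (p≤∣p∣ d) ∣d∣<ε)
    0<ε+d : 0ℚ < ε - - d
    0<ε+d = p<q⇒0<q-p (≤-<-trans (p≤∣p∣ (- d)) (subst (_< ε) (sym (∣-p∣≡∣p∣ d)) ∣d∣<ε))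
    upper : fromℕ N < (u + ε) * (u + ε)
    -- As `u ≥ 1`, the increment `(u + ε)² - u² = ε (2u + ε)` is at least `ε`, while `N - u² < ε`.
    upper = subst (fromℕ N <_)
      (solve 3 (λ N u ε →
        N :+ ((ε :- (:- (u :* u :- N))) :+ (ε :* ((u :- con 1ℚ) :+ u :+ ε)))
        := (u :+ ε) :* (u :+ ε)) refl (fromℕ N) u ε)
      (p<p+q (fromℕ N) (+-mono-<-≤ 0<ε+d
        (0≤p*q 0≤ε (+-mono-≤ (+-mono-≤ 0≤u-1 0≤u) 0≤ε))))
    lower : √Lower (fromℕ N) (u - ε)
    lower with u - ε <? 0ℚ
    ... | yes u-ε<0 = inj₁ u-ε<0
    -- Here `ε ≤ u`, hence `u² - (u - ε)² = ε (u + (u - ε)) ≥ ε`, while `u² - N < ε`.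
    ... | no  u-ε≮0 = inj₂ (subst ((u - ε) * (u - ε) <_)
      (solve 3 (λ N u ε →
        (u :- ε) :* (u :- ε) :+ ((ε :- (u :* u :- N)) :+ ε :* ((u :- con 1ℚ) :+ (u :- ε)))
        := N) refl (fromℕ N) u ε)
      (p<p+q _ (+-mono-<-≤ 0<ε-d (0≤p*q 0≤ε (+-mono-≤ 0≤u-1 (≮⇒≥ u-ε≮0))))))

  √-limit : ∀ N (u : ℕ → ℚ) → (∀ m → 1ℚ ≤ u m) →
            (∀ ε → 0ℚ < ε → ∃[ M ] (∀ m → M ℕ.≤ m → ∣ u m * u m - fromℕ N ∣ < ε)) →
            u ⟶ √ N
  √-limit N u 1≤u u²→N ε 0<ε = let M , close = u²→N ε 0<ε in
    M , λ m M≤m → ∣u²-N∣<ε⇒∣u-√N∣<ε N (1≤u m) 0<ε (close m M≤m)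

  -- The Möbius map x ↦ (A x + N B) / (B x + A) fixes ±√N.
  module _ (N A B : ℚ) (∣det∣≡1 : ∣ A * A - N * (B * B) ∣ ≡ 1ℚ)
           (2≤A : fromℕ 2 ≤ A) (0≤B : 0ℚ ≤ B)
           (x y : ℚ) (0≤x : 0ℚ ≤ x) (y≡Mx : y * (B * x + A) ≡ A * x + N * B) where

    private
      D = B * x + A
      2≤D : fromℕ 2 ≤ D
      2≤D = ≤-trans 2≤A (subst (A ≤_) (+-comm A (B * x)) (p≤p+q A (0≤p*q 0≤B 0≤x)))
      0≤D : 0ℚ ≤ D
      0≤D = ≤-trans (0≤fromℕ 2) 2≤D

    -- The product `(A + B √N) (x + √N)` is `(A x + N B) + (B x + A) √N`. Norms are multiplicative,
    -- which gives the identity once the denominator `D` of `y` is cleared.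
    möbius-square : (y * y - N) * (D * D) ≡ (A * A - N * (B * B)) * (x * x - N)
    möbius-square = begin
      (y * y - N) * (D * D)
        ≡⟨ solve 3 (λ y N D → (y :* y :- N) :* (D :* D) := (y :* D) :* (y :* D) :- N :* (D :* D)) refl y N D ⟩
      (y * D) * (y * D) - N * (D * D)
        ≡⟨ cong (λ t → t * t - N * (D * D)) y≡Mx ⟩
      (A * x + N * B) * (A * x + N * B) - N * (D * D)
        ≡⟨ solve 4 (λ A B N x →
             (A :* x :+ N :* B) :* (A :* x :+ N :* B) :- N :* ((B :* x :+ A) :* (B :* x :+ A))
             := (A :* A :- N :* (B :* B)) :* (x :* x :- N)) refl A B N x ⟩
      (A * A - N * (B * B)) * (x * x - N) ∎
      where
      open ≡-Reasoning
      open +-*-Solver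

    -- By `möbius-square` the new error is the old one divided by `D²`, and `D ≥ 2`.
    möbius-halves : ∣ y * y - N ∣ + ∣ y * y - N ∣ ≤ ∣ x * x - N ∣
    möbius-halves = begin
      e + e                     ≤⟨ p≤p+q (e + e) (0≤p*q 0≤r (0≤∣p∣ (y * y - N))) ⟩
      e + e + r * e             ≡⟨ solve 2 (λ e D →
                                     e :+ e :+ (con (fromℕ 2) :+ con (fromℕ 4) :* (D :- con (fromℕ 2))
                                       :+ (D :- con (fromℕ 2)) :* (D :- con (fromℕ 2))) :* e
                                     := e :* (D :* D)) refl e D ⟩
      e * (D * D)               ≡⟨ cong (e *_) (0≤p⇒∣p∣≡p (0≤p*q 0≤D 0≤D)) ⟨
      e * ∣ D * D ∣             ≡⟨ ∣p*q∣≡∣p∣*∣q∣ (y * y - N) (D * D) ⟨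
      ∣ (y * y - N) * (D * D) ∣ ≡⟨ cong ∣_∣ möbius-square ⟩
      ∣ (A * A - N * (B * B)) * (x * x - N) ∣
                                ≡⟨ ∣p*q∣≡∣p∣*∣q∣ (A * A - N * (B * B)) (x * x - N) ⟩
      ∣ A * A - N * (B * B) ∣ * ∣ x * x - N ∣
                                ≡⟨ cong (_* ∣ x * x - N ∣) ∣det∣≡1 ⟩
      1ℚ * ∣ x * x - N ∣        ≡⟨ *-identityˡ ∣ x * x - N ∣ ⟩
      ∣ x * x - N ∣             ∎
      where
      open ≤-Reasoning
      open +-*-Solver
      e = ∣ y * y - N ∣
      -- This is `D² - 2`, expanded in powers of `D - 2` so that every term is visibly nonnegative.
      r = fromℕ 2 + fromℕ 4 * (D - fromℕ 2) + (D - fromℕ 2) * (D - fromℕ 2)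
      0≤D-2 = p≤q⇒0≤q-p 2≤D
      0≤r : 0ℚ ≤ r
      0≤r = +-mono-≤ (+-mono-≤ (0≤fromℕ 2) (0≤p*q (0≤fromℕ 4) 0≤D-2)) (0≤p*q 0≤D-2 0≤D-2)

  -- Convergents of continued fractions.

  tail-positive : ∀ a (a⁺ : TailPositive a) m → Positive (convergent (a ∘ suc) (a⁺ ∘ suc) m)
  tail-positive a a⁺ m = convergent-positive (a ∘ suc) (a⁺ ∘ suc) (a⁺ 0) m

  tail-nonZero : ∀ a (a⁺ : TailPositive a) m → NonZero (convergent (a ∘ suc) (a⁺ ∘ suc) m)
  tail-nonZero a a⁺ m = pos⇒nonZero (convergent (a ∘ suc) (a⁺ ∘ suc) m) {{tail-positive a a⁺ m}}

  -- The two reciprocals may carry different proofs that their argument is nonzero; these proofs are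
  -- irrelevant.
  1/-cong : ∀ {p q} .{{_ : NonZero p}} .{{_ : NonZero q}} → p ≡ q → 1/ p ≡ 1/ q
  1/-cong refl = refl

  convergent-cong : ∀ a (a⁺ : TailPositive a) b (b⁺ : TailPositive b) → a ≗ b →
                    ∀ m → convergent a a⁺ m ≡ convergent b b⁺ m
  convergent-cong a a⁺ b b⁺ a≗b zero    = cong (_/ 1) (a≗b 0)
  convergent-cong a a⁺ b b⁺ a≗b (suc m) = cong₂ _+_ (cong (_/ 1) (a≗b 0))
    (1/-cong {{tail-nonZero a a⁺ m}} {{tail-nonZero b b⁺ m}}
      (convergent-cong (a ∘ suc) (a⁺ ∘ suc) (b ∘ suc) (b⁺ ∘ suc) (a≗b ∘ suc) m))

  -- Serves the closing entry `2n = n + n` of the block: the expansion from that entry on is the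
  -- whole expansion with `n` added to its head.
  convergent-+-head : ∀ a (a⁺ : TailPositive a) b (b⁺ : TailPositive b) h →
                      b 0 / 1 ≡ h + a 0 / 1 → b ∘ suc ≗ a ∘ suc →
                      ∀ m → convergent b b⁺ m ≡ h + convergent a a⁺ m
  convergent-+-head a a⁺ b b⁺ h b₀≡h+a₀ b≗a zero    = b₀≡h+a₀
  convergent-+-head a a⁺ b b⁺ h b₀≡h+a₀ b≗a (suc m) = trans
    (cong₂ _+_ b₀≡h+a₀ (1/-cong {{tail-nonZero b b⁺ m}} {{tail-nonZero a a⁺ m}}
      (convergent-cong (b ∘ suc) (b⁺ ∘ suc) (a ∘ suc) (a⁺ ∘ suc) b≗a m)))
    (+-assoc h (a 0 / 1) _)

  -- If the tail is `p / q`, the convergent is `(a₀ p + q) / p`. With denominators cleared, the step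
  -- can be iterated without any division.
  convergent-suc : ∀ a (a⁺ : TailPositive a) m {p q} →
                   convergent (a ∘ suc) (a⁺ ∘ suc) m * q ≡ p →
                   convergent a a⁺ (suc m) * p ≡ a 0 / 1 * p + q
  convergent-suc a a⁺ m {p} {q} tq≡p = trans (*-distribʳ-+ p (a 0 / 1) 1/t)
    (cong (λ x → a 0 / 1 * p + x) (begin
      1/t * p       ≡⟨ cong (1/t *_) tq≡p ⟨
      1/t * (t * q) ≡⟨ *-assoc 1/t t q ⟨
      1/t * t * q   ≡⟨ cong (_* q) (*-inverseˡ t) ⟩
      1ℚ * q        ≡⟨ *-identityˡ q ⟩
      q             ∎))
    where
    open ≡-Reasoning
    t = convergent (a ∘ suc) (a⁺ ∘ suc) m
    instance
      t≢0 = tail-nonZero a a⁺ m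
    1/t = 1/ t

  head≤convergent : ∀ a (a⁺ : TailPositive a) m → a 0 / 1 ≤ convergent a a⁺ m
  head≤convergent a a⁺ zero    = ≤-refl
  head≤convergent a a⁺ (suc m) = p≤p+q (a 0 / 1) (<⇒≤ (positive⁻¹ _ {{1/pos⇒pos
    (convergent (a ∘ suc) (a⁺ ∘ suc) m) {{tail-positive a a⁺ m}}}}))

  -- The recurrence is the Möbius map with its denominator cleared, so `∣ u² - N ∣` at least halves
  -- over `ℓ` steps. The bound on `a 0` keeps every convergent at least 1, which the passage from
  -- squares to roots requires.
  convergent⟶√ : ∀ N A B → ∣ A * A - fromℕ N * (B * B) ∣ ≡ 1ℚ → fromℕ 2 ≤ A → 0ℚ ≤ B →
                 ∀ ℓ .{{_ : ℕ.NonZero ℓ}} a (a⁺ : TailPositive a) → 1ℚ ≤ a 0 / 1 →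
                 (∀ m → convergent a a⁺ (ℓ ℕ.+ m) * (B * convergent a a⁺ m + A)
                        ≡ A * convergent a a⁺ m + fromℕ N * B) →
                 convergent a a⁺ ⟶ √ N
  convergent⟶√ N A B ∣det∣≡1 2≤A 0≤B ℓ a a⁺ 1≤a₀ recurrence =
    √-limit N u 1≤u (halving⇒vanishing ℓ (λ m → ∣ u m * u m - fromℕ N ∣)
      (λ m → 0≤∣p∣ (u m * u m - fromℕ N))
      (λ m → möbius-halves (fromℕ N) A B ∣det∣≡1 2≤A 0≤B (u m) (u (ℓ ℕ.+ m))
               (≤-trans (0≤fromℕ 1) (1≤u m)) (recurrence m)))
    where
    u = convergent a a⁺
    1≤u : ∀ m → 1ℚ ≤ u m
    1≤u m = ≤-trans 1≤a₀ (head≤convergent a a⁺ m)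

  -- Eventually periodic sequences and shortest blocks.

  [toℕi+kn]modn≡i : ∀ {n} .{{_ : ℕ.NonZero n}} (i : Fin n) k → (toℕ i ℕ.+ k ℕ.* n) mod n ≡ i
  [toℕi+kn]modn≡i {n} i k = Fin.toℕ-injective (begin
    toℕ ((toℕ i ℕ.+ k ℕ.* n) mod n) ≡⟨ Fin.toℕ-fromℕ< (ℕ.m%n<n (toℕ i ℕ.+ k ℕ.* n) n) ⟩
    (toℕ i ℕ.+ k ℕ.* n) ℕ.% n       ≡⟨ ℕ.[m+kn]%n≡m%n (toℕ i) k n ⟩
    toℕ i ℕ.% n                     ≡⟨ ℕ.m<n⇒m%n≡m (Fin.toℕ<n i) ⟩
    toℕ i                           ∎)
    where open ≡-Reasoning

  overline-periodic : ∀ {A : Set} pre (b : List⁺ A) i → length pre ℕ.≤ i →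
                      [ pre ,overline b ] (i ℕ.+ List⁺.length b) ≡ [ pre ,overline b ] i
  overline-periodic []        b i _ = cong (lookup (toList b)) (Fin.toℕ-injective
    (trans (Fin.toℕ-fromℕ< (ℕ.m%n<n (i ℕ.+ ℓ) ℓ))
      (trans (ℕ.[m+n]%n≡m%n i ℓ) (sym (Fin.toℕ-fromℕ< (ℕ.m%n<n i ℓ))))))
    where ℓ = List⁺.length b
  overline-periodic (x ∷ pre) b (suc i) (ℕ.s≤s pre≤i) = overline-periodic pre b i pre≤i

  -- Index 0 is left out: the entry `x` lies in the preperiod and need not recur.
  overline-shift : ∀ {A : Set} x (b : List⁺ A) i →
                   [ x ∷ [] ,overline b ] (List⁺.length b ℕ.+ suc i) ≡ [ x ∷ [] ,overline b ] (suc i)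
  overline-shift x b i = trans
    (cong [ x ∷ [] ,overline b ] (ℕ.+-comm (List⁺.length b) (suc i)))
    (overline-periodic (x ∷ []) b (suc i) (ℕ.s≤s ℕ.z≤n))

  overline-tailPositive : ∀ x (b : List⁺ ℤ) → (∀ i → + 0 ℤ.< lookup (toList b) i) →
                          TailPositive [ x ∷ [] ,overline b ]
  overline-tailPositive x b 0<b i = 0<b (i mod List⁺.length b)

  -- A shift by the length of a shorter block `b` takes a late occurrence of the last entry to an
  -- earlier position in the next copy of `y ∷ ys`, where the entry is different.
  distinct-last⇒shortest : ∀ x y (ys : List ℤ) →
    (∀ i → lookup (y ∷ ys) (Fin.inject₁ i) ≢ lookup (y ∷ ys) (Fin.fromℕ (length ys))) →
    ∀ b → IsRepeatingBlock [ x ∷ [] ,overline y ∷ ys ] b → suc (length ys) ℕ.≤ List⁺.length b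
  distinct-last⇒shortest x y ys distinct b@(z ∷ zs) (pre , a≗) =
    ℕ.≮⇒≥ λ { (ℕ.s≤s zs<ys) → distinct (Fin.fromℕ< zs<ys) (last-repeats zs<ys) }
    where
    open ≡-Reasoning
    l = length ys
    a = [ x ∷ [] ,overline y ∷ ys ]
    k = length pre
    -- The last position in copy number `k` of `y ∷ ys`, counted from 0; the outer `suc` skips `x`.
    -- Taking `k = length pre` puts `i` past `pre`.
    i = suc (l ℕ.+ k ℕ.* suc l)
    pre≤i : k ℕ.≤ i
    pre≤i = ℕ.m≤n⇒m≤1+n (ℕ.≤-trans (ℕ.m≤m*n k (suc l)) (ℕ.m≤n+m (k ℕ.* suc l) l))
    a-at : ∀ j k → a (suc (toℕ j ℕ.+ k ℕ.* suc l)) ≡ lookup (y ∷ ys) j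
    a-at j k = cong (lookup (y ∷ ys)) ([toℕi+kn]modn≡i j k)
    last-repeats : (zs<ys : length zs ℕ.< l) →
      lookup (y ∷ ys) (Fin.inject₁ (Fin.fromℕ< zs<ys)) ≡ lookup (y ∷ ys) (Fin.fromℕ l)
    last-repeats zs<ys = begin
      lookup (y ∷ ys) j                           ≡⟨ a-at j (suc k) ⟨
      a (suc (toℕ j ℕ.+ suc k ℕ.* suc l))         ≡⟨ cong a index ⟩
      a (i ℕ.+ suc (length zs))                   ≡⟨ a≗ (i ℕ.+ suc (length zs)) ⟩
      [ pre ,overline b ] (i ℕ.+ suc (length zs)) ≡⟨ overline-periodic pre b i pre≤i ⟩
      [ pre ,overline b ] i                       ≡⟨ a≗ i ⟨
      a i                                         ≡⟨ cong (λ t → a (suc (t ℕ.+ k ℕ.* suc l))) (Fin.toℕ-fromℕ l) ⟨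
      a (suc (toℕ (Fin.fromℕ l) ℕ.+ k ℕ.* suc l)) ≡⟨ a-at (Fin.fromℕ l) k ⟩
      lookup (y ∷ ys) (Fin.fromℕ l)               ∎
      where
      j = Fin.inject₁ (Fin.fromℕ< zs<ys)
      toℕj≡∣zs∣ : toℕ j ≡ length zs
      toℕj≡∣zs∣ = trans (Fin.toℕ-inject₁ (Fin.fromℕ< zs<ys)) (Fin.toℕ-fromℕ< zs<ys)
      -- From the last position of copy `k`, a step of `1 + length zs` lands at position `length zs`
      -- of copy `k + 1`.
      index : suc (toℕ j ℕ.+ suc k ℕ.* suc l) ≡ i ℕ.+ suc (length zs)
      index = cong suc (begin
        toℕ j ℕ.+ suc (l ℕ.+ k ℕ.* suc l)     ≡⟨ cong (ℕ._+ suc (l ℕ.+ k ℕ.* suc l)) toℕj≡∣zs∣ ⟩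
        length zs ℕ.+ suc (l ℕ.+ k ℕ.* suc l) ≡⟨ ℕ.+-suc (length zs) (l ℕ.+ k ℕ.* suc l) ⟩
        suc (length zs) ℕ.+ (l ℕ.+ k ℕ.* suc l) ≡⟨ ℕ.+-comm (suc (length zs)) (l ℕ.+ k ℕ.* suc l) ⟩
        l ℕ.+ k ℕ.* suc l ℕ.+ suc (length zs) ∎)

  -- The numbers n² + 4 and 2n as rationals, and comparisons with 2n.

  fromℕ[n²+4] : ∀ n → fromℕ (n ℕ.^ 2 ℕ.+ 4) ≡ fromℕ n * fromℕ n + fromℕ 4
  fromℕ[n²+4] n = begin
    fromℕ (n ℕ.^ 2 ℕ.+ 4)           ≡⟨ cong (λ t → fromℕ (n ℕ.* t ℕ.+ 4)) (ℕ.*-identityʳ n) ⟩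
    fromℕ (n ℕ.* n ℕ.+ 4)           ≡⟨ fromℕ-+ (n ℕ.* n) 4 ⟩
    fromℕ (n ℕ.* n) + fromℕ 4       ≡⟨ cong (_+ fromℕ 4) (fromℕ-* n n) ⟩
    fromℕ n * fromℕ n + fromℕ 4     ∎
    where open ≡-Reasoning

  fromℕ-double : ∀ n → fromℕ (2 ℕ.* n) ≡ fromℕ n + fromℕ n
  fromℕ-double n = trans (cong (λ t → fromℕ (n ℕ.+ t)) (ℕ.+-identityʳ n)) (fromℕ-+ n n)

  n<2*n : ∀ {n} → 1 ℕ.≤ n → n ℕ.< 2 ℕ.* n
  n<2*n {n} 1≤n = subst (n ℕ.<_) (cong (n ℕ.+_) (sym (ℕ.+-identityʳ n)))
    (ℕ.m<m+n n 1≤n)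

  <⇒+≢+ : ∀ {m n} → m ℕ.< n → + m ≢ + n
  <⇒+≢+ m<n = ℕ.<⇒≢ m<n ∘ ℤ.+-injective

  -- The case n = 2k.

  module Even {n k : ℕ} (1≤k : 1 ℕ.≤ k) (n≡k*2 : n ≡ k ℕ.* 2) where

    k≤n : k ℕ.≤ n
    k≤n = subst (k ℕ.≤_) (sym n≡k*2) (ℕ.m≤m*n k 2)

    a = [ + n ∷ [] ,overline + k ∷ + (2 ℕ.* n) ∷ [] ]

    1≤n : 1 ℕ.≤ n
    1≤n = ℕ.≤-trans 1≤k k≤n

    k<2n : k ℕ.< 2 ℕ.* n
    k<2n = ℕ.≤-<-trans k≤n (n<2*n 1≤n)

    a⁺ : TailPositive a
    a⁺ = overline-tailPositive (+ n) (+ k ∷ + (2 ℕ.* n) ∷ []) λ where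
      zero       → ℤ.+<+ 1≤k
      (suc zero) → ℤ.+<+ (ℕ.≤-<-trans ℕ.z≤n k<2n)

    -- `A + m √N` is the square of `(n + √N) / 2`, which has norm -1; `m` is both `k` as a rational
    -- and the coefficient `B` of the Möbius map.
    m N A : ℚ
    m = fromℕ k
    N = fromℕ (n ℕ.^ 2 ℕ.+ 4)
    A = m * (m + m) + 1ℚ

    n≡m+m : fromℕ n ≡ m + m
    n≡m+m = trans (cong fromℕ (trans n≡k*2 (ℕ.*-comm k 2))) (fromℕ-double k)

    N≡ : N ≡ (m + m) * (m + m) + fromℕ 4
    N≡ = trans (fromℕ[n²+4] n) (cong (λ t → t * t + fromℕ 4) n≡m+m)

    det≡1 : A * A - N * (m * m) ≡ 1ℚ
    det≡1 = trans (cong (λ t → A * A - t * (m * m)) N≡)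
      (solve 1 (λ m →
        (m :* (m :+ m) :+ con 1ℚ) :* (m :* (m :+ m) :+ con 1ℚ)
          :- ((m :+ m) :* (m :+ m) :+ con (fromℕ 4)) :* (m :* m)
        := con 1ℚ) refl m)
      where open +-*-Solver

    2≤A : fromℕ 2 ≤ A
    2≤A = subst (fromℕ 2 ≤_)
      -- `A = 2 + 2 (m - 1) (m + 1) + 1`, where `m ≥ 1`.
      (solve 1 (λ m →
        con (fromℕ 2) :+ ((m :- con 1ℚ) :* (con (fromℕ 2) :* m :+ con (fromℕ 2)) :+ con 1ℚ)
        := m :* (m :+ m) :+ con 1ℚ) refl m)
      (p≤p+q (fromℕ 2) (+-mono-≤
        (0≤p*q (p≤q⇒0≤q-p (fromℕ-mono-≤ 1≤k))
          (+-mono-≤ (0≤p*q (0≤fromℕ 2) (0≤fromℕ k)) (0≤fromℕ 2)))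
        (0≤fromℕ 1)))
      where open +-*-Solver

    -- Two uses of `convergent-suc` express the convergent of index `2 + i` through `w`, the
    -- convergent of the tail that starts at `2n`; then `w = n + u` closes the cycle.
    recurrence : ∀ i → convergent a a⁺ (2 ℕ.+ i) * (m * convergent a a⁺ i + A)
                       ≡ A * convergent a a⁺ i + N * m
    recurrence i = begin
      convergent a a⁺ (2 ℕ.+ i) * (m * u + A)       ≡⟨ cong (convergent a a⁺ (2 ℕ.+ i) *_) denominator ⟨
      convergent a a⁺ (2 ℕ.+ i) * (m * w + 1ℚ)      ≡⟨ step₀ ⟩
      fromℕ n * (m * w + 1ℚ) + w                    ≡⟨ cong₂ (λ x y → x * (m * y + 1ℚ) + y) n≡m+m w≡ ⟩
      (m + m) * (m * (m + m + u) + 1ℚ) + (m + m + u)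
        ≡⟨ solve 2 (λ m u →
             (m :+ m) :* (m :* (m :+ m :+ u) :+ con 1ℚ) :+ (m :+ m :+ u)
             := (m :* (m :+ m) :+ con 1ℚ) :* u
                  :+ ((m :+ m) :* (m :+ m) :+ con (fromℕ 4)) :* m) refl m u ⟩
      A * u + ((m + m) * (m + m) + fromℕ 4) * m     ≡⟨ cong (λ t → A * u + t * m) N≡ ⟨
      A * u + N * m                           ∎
      where
      open ≡-Reasoning
      open +-*-Solver
      u = convergent a a⁺ i
      a₁ a₂ : ℕ → ℤ
      a₁ = a ∘ suc
      a₂ = a₁ ∘ suc
      a₁⁺ : TailPositive a₁
      a₁⁺ = a⁺ ∘ suc
      a₂⁺ : TailPositive a₂
      a₂⁺ = a₁⁺ ∘ suc
      w = convergent a₂ a₂⁺ i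
      w≡ : w ≡ m + m + u
      w≡ = trans (convergent-+-head a a⁺ a₂ a₂⁺ (fromℕ n)
                   (fromℕ-double n) (overline-shift (+ n) (+ k ∷ + (2 ℕ.* n) ∷ [])) i)
                 (cong (_+ u) n≡m+m)
      denominator : m * w + 1ℚ ≡ m * u + A
      denominator = trans (cong (λ t → m * t + 1ℚ) w≡)
        (solve 2 (λ m u → m :* (m :+ m :+ u) :+ con 1ℚ
                          := m :* u :+ (m :* (m :+ m) :+ con 1ℚ)) refl m u)
      -- The chain of fractions starts from `w = w / 1`.
      step₁ : convergent a₁ a₁⁺ (suc i) * w ≡ m * w + 1ℚ
      step₁ = convergent-suc a₁ a₁⁺ i (*-identityʳ w)
      step₀ : convergent a a⁺ (2 ℕ.+ i) * (m * w + 1ℚ) ≡ fromℕ n * (m * w + 1ℚ) + w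
      step₀ = convergent-suc a a⁺ (suc i) step₁

    expansion : √ (n ℕ.^ 2 ℕ.+ 4) HasContinuedFraction a
    expansion = record
      { tailPositive = a⁺
      ; converges    = convergent⟶√ (n ℕ.^ 2 ℕ.+ 4) A m (cong ∣_∣ det≡1) 2≤A (0≤fromℕ k) 2 a a⁺
                         (fromℕ-mono-≤ 1≤n) recurrence
      }

    period : SequencePeriodLength a 2
    period = record
      { attained = + k ∷ + (2 ℕ.* n) ∷ [] , (+ n ∷ [] , λ _ → refl) , refl
      ; shortest = distinct-last⇒shortest (+ n) (+ k) (+ (2 ℕ.* n) ∷ [])
                     λ { zero → <⇒+≢+ k<2n }
      }

  -- The case n = 2k + 1.

  module Odd {n k : ℕ} (1≤k : 1 ℕ.≤ k) (n≡1+k*2 : n ≡ suc (k ℕ.* 2)) where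

    k≤n : k ℕ.≤ n
    k≤n = subst (k ℕ.≤_) (sym n≡1+k*2) (ℕ.m≤n⇒m≤1+n (ℕ.m≤m*n k 2))

    1≤n : 1 ℕ.≤ n
    1≤n = ℕ.≤-trans 1≤k k≤n

    a = [ + n ∷ [] ,overline + k ∷ + 1 ∷ + 1 ∷ + k ∷ + (2 ℕ.* n) ∷ [] ]

    k<2n : k ℕ.< 2 ℕ.* n
    k<2n = ℕ.≤-<-trans k≤n (n<2*n 1≤n)

    1<2n : 1 ℕ.< 2 ℕ.* n
    1<2n = ℕ.≤-<-trans 1≤k k<2n

    a⁺ : TailPositive a
    a⁺ = overline-tailPositive (+ n) (+ k ∷ + 1 ∷ + 1 ∷ + k ∷ + (2 ℕ.* n) ∷ []) λ where
      zero                         → ℤ.+<+ 1≤k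
      (suc zero)                   → ℤ.+<+ ℕ.≤-refl
      (suc (suc zero))             → ℤ.+<+ ℕ.≤-refl
      (suc (suc (suc zero)))       → ℤ.+<+ 1≤k
      (suc (suc (suc (suc zero)))) → ℤ.+<+ (ℕ.≤-<-trans ℕ.z≤n k<2n)

    -- `A + B √N` is the cube of `(n + √N) / 2`, hence again of norm -1. `n′` is `n` written as a
    -- polynomial in `m`, so that the facts below become polynomial identities.
    m N n′ A B : ℚ
    m = fromℕ k
    N = fromℕ (n ℕ.^ 2 ℕ.+ 4)
    n′ = m + m + 1ℚ
    B = m * m + m * m + n′
    A = n′ * (B + 1ℚ)

    n≡n′ : fromℕ n ≡ n′
    n≡n′ = begin
      fromℕ n                   ≡⟨ cong fromℕ n≡1+k*2 ⟩
      fromℕ (1 ℕ.+ k ℕ.* 2)     ≡⟨ fromℕ-+ 1 (k ℕ.* 2) ⟩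
      1ℚ + fromℕ (k ℕ.* 2)      ≡⟨ +-comm 1ℚ (fromℕ (k ℕ.* 2)) ⟩
      fromℕ (k ℕ.* 2) + 1ℚ      ≡⟨ cong (λ t → fromℕ t + 1ℚ) (ℕ.*-comm k 2) ⟩
      fromℕ (2 ℕ.* k) + 1ℚ      ≡⟨ cong (_+ 1ℚ) (fromℕ-double k) ⟩
      m + m + 1ℚ                ∎
      where open ≡-Reasoning

    N≡ : N ≡ n′ * n′ + fromℕ 4
    N≡ = trans (fromℕ[n²+4] n) (cong (λ t → t * t + fromℕ 4) n≡n′)

    0≤m : 0ℚ ≤ m
    0≤m = 0≤fromℕ k

    0≤m² : 0ℚ ≤ m * m
    0≤m² = 0≤p*q 0≤m 0≤m

    0≤n′ : 0ℚ ≤ n′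
    0≤n′ = +-mono-≤ (+-mono-≤ 0≤m 0≤m) (0≤fromℕ 1)

    0≤B : 0ℚ ≤ B
    0≤B = +-mono-≤ (+-mono-≤ 0≤m² 0≤m²) 0≤n′

    det≡-1 : A * A - N * (B * B) ≡ - 1ℚ
    det≡-1 = trans (cong (λ t → A * A - t * (B * B)) N≡)
      (solve 1 (λ m →
        let n = m :+ m :+ con 1ℚ
            B = m :* m :+ m :* m :+ n
            A = n :* (B :+ con 1ℚ)
        in A :* A :- (n :* n :+ con (fromℕ 4)) :* (B :* B) := :- con 1ℚ) refl m)
      where open +-*-Solver

    2≤A : fromℕ 2 ≤ A
    2≤A = subst (fromℕ 2 ≤_)
      -- Since `n′ = 1 + 2m` and `B + 1 = 2 + 2m² + 2m`, the product is 2 plus nonnegative terms.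
      (solve 1 (λ m →
        let n = m :+ m :+ con 1ℚ
            B = m :* m :+ m :* m :+ n
        in con (fromℕ 2) :+ (m :* m :+ m :* m :+ (m :+ m) :+ (m :+ m) :* (B :+ con 1ℚ))
           := n :* (B :+ con 1ℚ)) refl m)
      (p≤p+q (fromℕ 2) (+-mono-≤
        (+-mono-≤ (+-mono-≤ 0≤m² 0≤m²) 0≤2m)
        (0≤p*q 0≤2m (+-mono-≤ 0≤B (0≤fromℕ 1)))))
      where
      open +-*-Solver
      0≤2m = +-mono-≤ 0≤m 0≤m

    recurrence : ∀ i → convergent a a⁺ (5 ℕ.+ i) * (B * convergent a a⁺ i + A)
                       ≡ A * convergent a a⁺ i + N * B
    recurrence i = begin
      v * (B * u + A)          ≡⟨ cong (v *_) denominator ⟨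
      v * p₁                   ≡⟨ step₀ ⟩
      fromℕ n * p₁ + p₂        ≡⟨ cong (λ t → t * p₁ + p₂) n≡n′ ⟩
      n′ * p₁ + p₂             ≡⟨ numerator ⟩
      A * u + (n′ * n′ + fromℕ 4) * B ≡⟨ cong (λ t → A * u + t * B) N≡ ⟨
      A * u + N * B      ∎
      where
      open ≡-Reasoning
      open +-*-Solver
      u = convergent a a⁺ i
      v = convergent a a⁺ (5 ℕ.+ i)
      a₁ a₂ a₃ a₄ a₅ : ℕ → ℤ
      a₁ = a ∘ suc
      a₂ = a₁ ∘ suc
      a₃ = a₂ ∘ suc
      a₄ = a₃ ∘ suc
      a₅ = a₄ ∘ suc
      a₁⁺ : TailPositive a₁
      a₁⁺ = a⁺ ∘ suc
      a₂⁺ : TailPositive a₂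
      a₂⁺ = a₁⁺ ∘ suc
      a₃⁺ : TailPositive a₃
      a₃⁺ = a₂⁺ ∘ suc
      a₄⁺ : TailPositive a₄
      a₄⁺ = a₃⁺ ∘ suc
      a₅⁺ : TailPositive a₅
      a₅⁺ = a₄⁺ ∘ suc
      w = convergent a₅ a₅⁺ i
      -- Continuants of `k, 1, 1, k`, built from the end: with `p₅ = w`, the tail `a_j` has the
      -- convergent `p_j / p_(j+1)` for `j` from 4 down to 1.
      p₄ = m * w + 1ℚ
      p₃ = 1ℚ * p₄ + w
      p₂ = 1ℚ * p₃ + p₄
      p₁ = m * p₂ + p₃
      step₄ : convergent a₄ a₄⁺ (1 ℕ.+ i) * w ≡ p₄
      step₄ = convergent-suc a₄ a₄⁺ i (*-identityʳ w)
      step₃ : convergent a₃ a₃⁺ (2 ℕ.+ i) * p₄ ≡ p₃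
      step₃ = convergent-suc a₃ a₃⁺ (1 ℕ.+ i) step₄
      step₂ : convergent a₂ a₂⁺ (3 ℕ.+ i) * p₃ ≡ p₂
      step₂ = convergent-suc a₂ a₂⁺ (2 ℕ.+ i) step₃
      step₁ : convergent a₁ a₁⁺ (4 ℕ.+ i) * p₂ ≡ p₁
      step₁ = convergent-suc a₁ a₁⁺ (3 ℕ.+ i) step₂
      step₀ : v * p₁ ≡ fromℕ n * p₁ + p₂
      step₀ = convergent-suc a a⁺ (4 ℕ.+ i) step₁
      w≡ : w ≡ n′ + u
      -- `a₅` starts at the entry `2n = n + n` and from there on agrees with `a` after its head.
      w≡ = trans (convergent-+-head a a⁺ a₅ a₅⁺ (fromℕ n) (fromℕ-double n)
                   (overline-shift (+ n) (+ k ∷ + 1 ∷ + 1 ∷ + k ∷ + (2 ℕ.* n) ∷ [])) i)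
                 (cong (_+ u) n≡n′)
      denominator : p₁ ≡ B * u + A
      denominator = trans
        (cong (λ w → m * (1ℚ * (1ℚ * (m * w + 1ℚ) + w) + (m * w + 1ℚ))
                       + (1ℚ * (m * w + 1ℚ) + w)) w≡)
        (solve 2 (λ m u →
          let n = m :+ m :+ con 1ℚ
              B = m :* m :+ m :* m :+ n
              A = n :* (B :+ con 1ℚ)
              w = n :+ u
              p₄ = m :* w :+ con 1ℚ
              p₃ = con 1ℚ :* p₄ :+ w
              p₂ = con 1ℚ :* p₃ :+ p₄
          in m :* p₂ :+ p₃ := B :* u :+ A) refl m u)
      numerator : n′ * p₁ + p₂ ≡ A * u + (n′ * n′ + fromℕ 4) * B
      numerator = trans
        (cong₂ (λ p w → n′ * p + (1ℚ * (1ℚ * (m * w + 1ℚ) + w) + (m * w + 1ℚ)))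
          denominator w≡)
        (solve 2 (λ m u →
          let n = m :+ m :+ con 1ℚ
              B = m :* m :+ m :* m :+ n
              A = n :* (B :+ con 1ℚ)
              w = n :+ u
              p₄ = m :* w :+ con 1ℚ
          in n :* (B :* u :+ A) :+ (con 1ℚ :* (con 1ℚ :* p₄ :+ w) :+ p₄)
             := A :* u :+ (n :* n :+ con (fromℕ 4)) :* B) refl m u)

    expansion : √ (n ℕ.^ 2 ℕ.+ 4) HasContinuedFraction a
    expansion = record
      { tailPositive = a⁺
      ; converges    = convergent⟶√ (n ℕ.^ 2 ℕ.+ 4) A B (cong ∣_∣ det≡-1) 2≤A 0≤B 5 a a⁺
                         (fromℕ-mono-≤ 1≤n) recurrence
      }

    period : SequencePeriodLength a 5
    period = record
      { attained = + k ∷ + 1 ∷ + 1 ∷ + k ∷ + (2 ℕ.* n) ∷ [] , (+ n ∷ [] , λ _ → refl) , refl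
      ; shortest = distinct-last⇒shortest (+ n) (+ k) (+ 1 ∷ + 1 ∷ + k ∷ + (2 ℕ.* n) ∷ []) λ where
          zero                   → <⇒+≢+ k<2n
          (suc zero)             → <⇒+≢+ 1<2n
          (suc (suc zero))       → <⇒+≢+ 1<2n
          (suc (suc (suc zero))) → <⇒+≢+ k<2n
      }

open import Data.Nat using (ℕ; zero; suc; _+_; _*_; _∸_; _^_; _/_; _%_; _≤_; _≥_; z≤n; s≤s)
open import Data.Nat.DivMod using (m*n/n≡m; m*n/m*o≡n/o; m%n<n; m≡m%n+[m/n]*n)
open import Data.Nat.Divisibility using (_∣_; _∤_; divides; m%n≡0⇒n∣m)
open import Data.Integer using (+_)
open import Data.List using ([]; _∷_)
open import Data.List.NonEmpty using (_∷_)
open import Data.Product using (_×_; ∃-syntax; _,_)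
open import Relation.Binary.PropositionalEquality using (_≡_; refl; trans; cong; subst)
open import Relation.Nullary using (contradiction)

-- Parity of n and the two cases of the theorem.

odd⇒1+k*2 : ∀ {n} → 2 ∤ n → ∃[ k ] n ≡ suc (k * 2)
odd⇒1+k*2 {n} 2∤n with n % 2 in n%2≡r | m%n<n n 2
... | 0 | _ = contradiction (m%n≡0⇒n∣m n 2 n%2≡r) 2∤n
... | 1 | _ = n / 2 , trans (m≡m%n+[m/n]*n n 2) (cong (_+ n / 2 * 2) n%2≡r)
... | suc (suc _) | s≤s (s≤s ())

2*[k*2]/4≡k : ∀ k → 2 * (k * 2) / 4 ≡ k
2*[k*2]/4≡k k = trans (m*n/m*o≡n/o 2 (k * 2) 2) (m*n/n≡m k 2)

4≤2*[k*2]⇒1≤k : ∀ k → 4 ≤ 2 * (k * 2) → 1 ≤ k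
4≤2*[k*2]⇒1≤k zero    ()
4≤2*[k*2]⇒1≤k (suc k) _ = s≤s z≤n

-- The bound rules out `n = 1`, for which the entry `(n - 1) / 2` would be 0 and so no partial
-- quotient.
4≤2*[1+k*2]⇒1≤k : ∀ k → 4 ≤ 2 * suc (k * 2) → 1 ≤ k
4≤2*[1+k*2]⇒1≤k zero    (s≤s (s≤s ()))
4≤2*[1+k*2]⇒1≤k (suc k) _ = s≤s z≤n

-- `q` stands for the integer quotient `2n / 4`; as a variable it can be identified with `k` by
-- matching on `refl`.
even-expansion : ∀ {n k q} → 1 ≤ k → n ≡ k * 2 → q ≡ k →
  PeriodLength (√ (n ^ 2 + 4)) 2 ×
  √ (n ^ 2 + 4) HasContinuedFraction [ + n ∷ [] ,overline + q ∷ + (2 * n) ∷ [] ]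
even-expansion 1≤k n≡k*2 refl = (a , expansion , period) , expansion
  where open Even 1≤k n≡k*2

odd-expansion : ∀ {n k q} → 1 ≤ k → n ≡ suc (k * 2) → q ≡ k →
  PeriodLength (√ (n ^ 2 + 4)) 5 ×
  √ (n ^ 2 + 4) HasContinuedFraction
    [ + n ∷ [] ,overline + q ∷ + 1 ∷ + 1 ∷ + q ∷ + (2 * n) ∷ [] ]
odd-expansion 1≤k n≡1+k*2 refl = (a , expansion , period) , expansion
  where open Odd 1≤k n≡1+k*2

mainTheorem3 : (n : ℕ) → n ≥ 1 →
    let j = 4
        N = n ^ 2 + j
    in j ≤ 2 * n →
       (2 ∣ n →
          PeriodLength (√ N) 2 ×
          √ N HasContinuedFraction
            [ + n ∷ [] ,overline + (2 * n / j) ∷ + (2 * n) ∷ [] ])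
     × (2 ∤ n →
          PeriodLength (√ N) 5 ×
          √ N HasContinuedFraction
            [ + n ∷ [] ,overline
              + ((n ∸ 1) / 2) ∷ + 1 ∷ + 1 ∷ + ((n ∸ 1) / 2) ∷ + (2 * n) ∷ [] ])
mainTheorem3 n _ 4≤2n = even , odd
  where
  even : 2 ∣ n → _
  even (divides k n≡k*2) = even-expansion
    (4≤2*[k*2]⇒1≤k k (subst (λ n → 4 ≤ 2 * n) n≡k*2 4≤2n)) n≡k*2
    (trans (cong (λ n → 2 * n / 4) n≡k*2) (2*[k*2]/4≡k k))
  odd : 2 ∤ n → _
  odd 2∤n with odd⇒1+k*2 2∤n
  ... | k , n≡1+k*2 = odd-expansion
    (4≤2*[1+k*2]⇒1≤k k (subst (λ n → 4 ≤ 2 * n) n≡1+k*2 4≤2n)) n≡1+k*2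
    (trans (cong (λ n → (n ∸ 1) / 2) n≡1+k*2) (m*n/n≡m k 2))
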